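{- Let $G$ be a graph of order $n$ with minimum degree $\delta>0$. Then $$ \gamma_R(G)\le 2\left(1-\frac{2^{1/\delta}\,\delta}{(1+\delta)^{1+1/\delta}}\right)n . $$
   Context: All graphs are finite and undirected, without loops or multiple edges. A Roman dominating function of a graph $G$ is a function $f:V(G)\to\{0,1,2\}$ such that every vertex $u$ with $f(u)=0$ is adjacent to at least one vertex $v$ with $f(v)=2$. Its weight is $f(V(G))=\sum_{v\in V(G)}f(v)$. The Roman domination number $\gamma_R(G)$ is the minimum weight of a Roman dominating function of $G$. -}

module Defs where

open import Data.Fin.Base as Fin using (Fin; toℕ; finToFun; funToFin)
open import Data.Fin.Patterns using (0F; 2F)
import Data.Fin.Properties as Fin
open import Data.Fin.Subset using (Subset; ∣_∣)
open import Data.Integer.Base as ℤ using (ℤ; +_; -[1+_])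
import Data.Integer.Properties as ℤ
import Data.Integer.Tactic.RingSolver as ℤ-RingSolver
open import Data.List.Base using (List; map; filter; allFin)
open import Data.List.Extrema.Nat using (argmin; argmin-all; f[argmin]≤v⁺; min)
open import Data.List.Membership.Propositional using (lose)
open import Data.List.Membership.Propositional.Properties
  using (∈-map⁺; ∈-filter⁺; ∈-allFin)
open import Data.List.Relation.Unary.All.Properties using (all-filter)
open import Data.Nat.Base as ℕ using (ℕ; zero; suc; NonZero; s≤s)
import Data.Nat.Properties as ℕ
import Data.Nat.Tactic.RingSolver as ℕ-RingSolver
open import Data.Product.Base using (∃; _×_; _,_; proj₁; proj₂)
open import Data.Rational.Base as ℚ using (ℚ; 0ℚ; 1ℚ; ½; Positive)
import Data.Rational.Properties as ℚ
open import Data.Rational.Solver using (module +-*-Solver)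
open import Data.Rational.Unnormalised.Base as ℚᵘ using (ℚᵘ; mkℚᵘ)
import Data.Rational.Unnormalised.Properties as ℚᵘ
open import Data.Sum.Base using (inj₁; inj₂)
open import Data.Vec.Base using (tabulate)
open import Function.Base using (_∘_; const)
open import Relation.Binary.PropositionalEquality
  using (_≡_; _≗_; refl; sym; trans; cong; cong₂; subst)
open import Relation.Nullary.Decidable using (Dec; yes; no; does; _×-dec_; _→-dec_)
open import Relation.Nullary.Negation using (¬_)

import Algebra.Properties.CommutativeMonoid.Sum ℕ.+-0-commutativeMonoid as Σℕ

record Graph (n : ℕ) : Set₁ where
  field
    Adj     : Fin n → Fin n → Set
    adj?    : ∀ u v → Dec (Adj u v)
    symAdj  : ∀ {u v} → Adj u v → Adj v u
    irrefl  : ∀ {v} → ¬ Adj v v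

module _ {n : ℕ} (G : Graph n) where
  open Graph G

  neighbours : Fin n → Subset n
  neighbours v = tabulate (does ∘ adj? v)

  degree : Fin n → ℕ
  degree v = ∣ neighbours v ∣

  IsRomanDominating : (Fin n → Fin 3) → Set
  IsRomanDominating f = ∀ u → f u ≡ 0F → ∃ λ v → Adj u v × f v ≡ 2F

  isRomanDominating? : ∀ f → Dec (IsRomanDominating f)
  isRomanDominating? f = Fin.all? λ u →
    (f u Fin.≟ 0F) →-dec Fin.any? λ v → adj? u v ×-dec (f v Fin.≟ 2F)

minDegree : ∀ {n} .{{_ : NonZero n}} → Graph n → ℕ
minDegree {suc n} G = min (degree G 0F) (map (degree G) (allFin (suc n)))

weight : ∀ {n} → (Fin n → Fin 3) → ℕ
weight f = Σℕ.sum (toℕ ∘ f)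

-- Up to pointwise equality, every function occurs in this list.
allFunctions : ∀ n → List (Fin n → Fin 3)
allFunctions n = map finToFun (allFin (3 ℕ.^ n))

module _ {n : ℕ} (G : Graph n) where

  romanDominatingFunctions : List (Fin n → Fin 3)
  romanDominatingFunctions = filter (isRomanDominating? G) (allFunctions n)

  -- The constant function 2 is Roman dominating, so it does not disturb the minimum.
  optimalRDF : Fin n → Fin 3
  optimalRDF = argmin weight (const 2F) romanDominatingFunctions

  γR : ℕ
  γR = weight optimalRDF

  γR-attained : IsRomanDominating G optimalRDF
  γR-attained = argmin-all weight {⊤ = const 2F} {xs = romanDominatingFunctions}
    (λ _ ()) (all-filter (isRomanDominating? G) (allFunctions n))

  γR-minimal : ∀ f → IsRomanDominating G f → γR ℕ.≤ weight f
  γR-minimal f fRDF = f[argmin]≤v⁺ {f = weight} (const 2F) romanDominatingFunctions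
    (inj₂ (lose f′∈ (ℕ.≤-reflexive (Σℕ.sum-cong-≗ (cong toℕ ∘ f′≗f)))))
    where
    f′ : Fin n → Fin 3
    f′ = finToFun (funToFin f)

    f′≗f : f′ ≗ f
    f′≗f = Fin.finToFun-funToFin f

    f′RDF : IsRomanDominating G f′
    f′RDF u f′u≡0 with fRDF u (trans (sym (f′≗f u)) f′u≡0)
    ... | v , uv , fv≡2 = v , uv , trans (f′≗f v) fv≡2

    f′∈ = ∈-filter⁺ (isRomanDominating? G) (∈-map⁺ finToFun (∈-allFin (funToFin f))) f′RDF

IsCauchy : (ℕ → ℚ) → Set
IsCauchy s = ∀ ε → .{{Positive ε}} → ∃ λ N → ∀ {i j} → N ℕ.≤ i → N ℕ.≤ j →
  ℚ.∣ s i ℚ.- s j ∣ ℚ.≤ ε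

record ℝ : Set where
  no-eta-equality
  field
    seq    : ℕ → ℚ
    cauchy : IsCauchy seq

open ℝ public

infix 4 _≤_

_≤_ : ℝ → ℝ → Set
x ≤ y = ∀ ε → .{{Positive ε}} → ∃ λ N → ∀ {i} → N ℕ.≤ i → seq x i ℚ.≤ seq y i ℚ.+ ε

-- Being bounded away from zero, as needed to invert a real constructively.
record Positiveᴿ (x : ℝ) : Set where
  no-eta-equality
  field
    bound    : ℚ
    bound>0  : Positive bound
    from     : ℕ
    lower    : ∀ {i} → from ℕ.≤ i → bound ℚ.≤ seq x i

open +-*-Solver

∣p-q∣≡∣q-p∣ : ∀ p q → ℚ.∣ p ℚ.- q ∣ ≡ ℚ.∣ q ℚ.- p ∣
∣p-q∣≡∣q-p∣ p q = trans (sym (ℚ.∣-p∣≡∣p∣ (p ℚ.- q)))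
  (cong ℚ.∣_∣ (solve 2 (λ p q → :- (p :- q) := q :- p) refl p q))

p≤∣p∣ : ∀ p → p ℚ.≤ ℚ.∣ p ∣
p≤∣p∣ p with ℚ.≤-total 0ℚ p
... | inj₁ 0≤p = ℚ.≤-reflexive (sym (ℚ.0≤p⇒∣p∣≡p 0≤p))
... | inj₂ p≤0 = ℚ.≤-trans p≤0 (ℚ.0≤∣p∣ p)

p≤q+∣p-q∣ : ∀ p q → p ℚ.≤ q ℚ.+ ℚ.∣ p ℚ.- q ∣
p≤q+∣p-q∣ p q = begin
  p                     ≡⟨ solve 2 (λ p q → p := q :+ (p :- q)) refl p q ⟩
  q ℚ.+ (p ℚ.- q)       ≤⟨ ℚ.+-monoʳ-≤ q (p≤∣p∣ (p ℚ.- q)) ⟩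
  q ℚ.+ ℚ.∣ p ℚ.- q ∣   ∎
  where open ℚ.≤-Reasoning

∣p-q∣≤ : ∀ {p q ε} → p ℚ.≤ q ℚ.+ ε → q ℚ.≤ p ℚ.+ ε → ℚ.∣ p ℚ.- q ∣ ℚ.≤ ε
∣p-q∣≤ {p} {q} {ε} p≤q+ε q≤p+ε with ℚ.∣p∣≡p∨∣p∣≡-p (p ℚ.- q)
... | inj₁ eq = begin
  ℚ.∣ p ℚ.- q ∣         ≡⟨ eq ⟩
  p ℚ.- q               ≤⟨ ℚ.+-monoˡ-≤ (ℚ.- q) p≤q+ε ⟩
  (q ℚ.+ ε) ℚ.- q       ≡⟨ solve 2 (λ q e → (q :+ e) :- q := e) refl q ε ⟩
  ε                     ∎
  where open ℚ.≤-Reasoning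
... | inj₂ eq = begin
  ℚ.∣ p ℚ.- q ∣         ≡⟨ eq ⟩
  ℚ.- (p ℚ.- q)         ≡⟨ solve 2 (λ p q → :- (p :- q) := q :- p) refl p q ⟩
  q ℚ.- p               ≤⟨ ℚ.+-monoˡ-≤ (ℚ.- p) q≤p+ε ⟩
  (p ℚ.+ ε) ℚ.- p       ≡⟨ solve 2 (λ p e → (p :+ e) :- p := e) refl p ε ⟩
  ε                     ∎
  where open ℚ.≤-Reasoning

pos⁻¹ : ∀ p .{{_ : Positive p}} → ℚ
pos⁻¹ p = (ℚ.1/ p) {{ℚ.pos⇒nonZero p}}

pos⁻¹-pos : ∀ p .{{_ : Positive p}} → Positive (pos⁻¹ p)
pos⁻¹-pos p = ℚ.1/pos⇒pos p

pos⁻¹-inverse : ∀ p .{{_ : Positive p}} → p ℚ.* pos⁻¹ p ≡ 1ℚ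
pos⁻¹-inverse p = ℚ.*-inverseʳ p {{ℚ.pos⇒nonZero p}}

pos-≤ : ∀ {p q} .{{_ : Positive p}} → p ℚ.≤ q → Positive q
pos-≤ {p} p≤q = ℚ.positive (ℚ.<-≤-trans (ℚ.positive⁻¹ p) p≤q)

pos⁻¹-anti : ∀ {p q} .{{_ : Positive p}} .{{_ : Positive q}} → p ℚ.≤ q → pos⁻¹ q ℚ.≤ pos⁻¹ p
pos⁻¹-anti {p} {q} p≤q = begin
  q⁻¹                   ≡⟨ sym (ℚ.*-identityʳ q⁻¹) ⟩
  q⁻¹ ℚ.* 1ℚ            ≡⟨ cong (q⁻¹ ℚ.*_) (sym (pos⁻¹-inverse p)) ⟩
  q⁻¹ ℚ.* (p ℚ.* p⁻¹)   ≤⟨ ℚ.*-monoˡ-≤-nonNeg q⁻¹ (ℚ.*-monoʳ-≤-nonNeg p⁻¹ p≤q) ⟩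
  q⁻¹ ℚ.* (q ℚ.* p⁻¹)   ≡⟨ solve 3 (λ a q b → a :* (q :* b) := (q :* a) :* b) refl q⁻¹ q p⁻¹ ⟩
  (q ℚ.* q⁻¹) ℚ.* p⁻¹   ≡⟨ cong (ℚ._* p⁻¹) (pos⁻¹-inverse q) ⟩
  1ℚ ℚ.* p⁻¹            ≡⟨ ℚ.*-identityˡ p⁻¹ ⟩
  p⁻¹                   ∎
  where
  open ℚ.≤-Reasoning
  p⁻¹ = pos⁻¹ p
  q⁻¹ = pos⁻¹ q
  instance
    _ = ℚ.pos⇒nonNeg p⁻¹ {{pos⁻¹-pos p}}
    _ = ℚ.pos⇒nonNeg q⁻¹ {{pos⁻¹-pos q}}

*-mono-≤-nonNeg : ∀ {p q r s} .{{_ : ℚ.NonNegative p}} .{{_ : ℚ.NonNegative s}} →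
                  p ℚ.≤ q → r ℚ.≤ s → p ℚ.* r ℚ.≤ q ℚ.* s
*-mono-≤-nonNeg {p} {q} {r} {s} p≤q r≤s =
  ℚ.≤-trans (ℚ.*-monoˡ-≤-nonNeg p r≤s) (ℚ.*-monoʳ-≤-nonNeg s p≤q)

record Bounded (s : ℕ → ℚ) : Set where
  no-eta-equality
  field
    bound    : ℚ
    bound>0  : Positive bound
    from     : ℕ
    upper    : ∀ {i} → from ℕ.≤ i → ℚ.∣ s i ∣ ℚ.≤ bound

bounded : ∀ x → Bounded (seq x)
bounded x = record
  { bound   = ℚ.∣ s N ∣ ℚ.+ 1ℚ
  ; bound>0 = ℚ.nonNeg+pos⇒pos ℚ.∣ s N ∣ {{ℚ.∣-∣-nonNeg (s N)}} 1ℚ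
  ; from    = N
  ; upper   = λ {i} N≤i → begin
      ℚ.∣ s i ∣                           ≡⟨ cong ℚ.∣_∣ (solve 2 (λ p q → p := q :+ (p :- q)) refl (s i) (s N)) ⟩
      ℚ.∣ s N ℚ.+ (s i ℚ.- s N) ∣         ≤⟨ ℚ.∣p+q∣≤∣p∣+∣q∣ (s N) (s i ℚ.- s N) ⟩
      ℚ.∣ s N ∣ ℚ.+ ℚ.∣ s i ℚ.- s N ∣     ≤⟨ ℚ.+-monoʳ-≤ ℚ.∣ s N ∣ (proj₂ (cauchy x 1ℚ) N≤i ℕ.≤-refl) ⟩
      ℚ.∣ s N ∣ ℚ.+ 1ℚ                    ∎
  }
  where
  open ℚ.≤-Reasoning
  s = seq x
  N = proj₁ (cauchy x 1ℚ)

fromℚ : ℚ → ℝ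
fromℚ q .seq    = const q
fromℚ q .cauchy = λ ε →
  0 , λ _ _ → subst (ℚ._≤ ε) (sym (cong ℚ.∣_∣ (ℚ.+-inverseʳ q))) (ℚ.<⇒≤ (ℚ.positive⁻¹ ε))

fromℕ : ℕ → ℝ
fromℕ m = fromℚ (+ m ℚ./ 1)

infix  8 -_
infixl 6 _+_ _-_
infixl 7 _*_ _÷_

_+_ : ℝ → ℝ → ℝ
(x + y) .seq i  = seq x i ℚ.+ seq y i
(x + y) .cauchy = cauchy′
  where
  cauchy′ : IsCauchy (λ i → seq x i ℚ.+ seq y i)
  cauchy′ ε = M ℕ.⊔ N , λ {i} {j} p q → begin
    ℚ.∣ (seq x i ℚ.+ seq y i) ℚ.- (seq x j ℚ.+ seq y j) ∣
      ≡⟨ cong ℚ.∣_∣ (solve 4 (λ a b c d → (a :+ b) :- (c :+ d) := (a :- c) :+ (b :- d)) refl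
           (seq x i) (seq y i) (seq x j) (seq y j)) ⟩
    ℚ.∣ (seq x i ℚ.- seq x j) ℚ.+ (seq y i ℚ.- seq y j) ∣
      ≤⟨ ℚ.∣p+q∣≤∣p∣+∣q∣ (seq x i ℚ.- seq x j) (seq y i ℚ.- seq y j) ⟩
    ℚ.∣ seq x i ℚ.- seq x j ∣ ℚ.+ ℚ.∣ seq y i ℚ.- seq y j ∣
      ≤⟨ ℚ.+-mono-≤ (proj₂ cx (ℕ.m⊔n≤o⇒m≤o M N p) (ℕ.m⊔n≤o⇒m≤o M N q))
                    (proj₂ cy (ℕ.m⊔n≤o⇒n≤o M N p) (ℕ.m⊔n≤o⇒n≤o M N q)) ⟩
    ½ ℚ.* ε ℚ.+ ½ ℚ.* ε
      ≡⟨ solve 1 (λ e → con ½ :* e :+ con ½ :* e := e) refl ε ⟩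
    ε ∎
    where
    open ℚ.≤-Reasoning
    instance _ = ℚ.pos*pos⇒pos ½ ε
    cx = cauchy x (½ ℚ.* ε)
    cy = cauchy y (½ ℚ.* ε)
    M = proj₁ cx
    N = proj₁ cy

-_ : ℝ → ℝ
(- x) .seq i  = ℚ.- seq x i
(- x) .cauchy = λ ε → proj₁ (cauchy x ε) , λ {i} {j} p q →
  subst (ℚ._≤ ε)
    (trans (∣p-q∣≡∣q-p∣ (seq x i) (seq x j))
      (cong ℚ.∣_∣ (solve 2 (λ a b → b :- a := :- a :- :- b) refl (seq x i) (seq x j))))
    (proj₂ (cauchy x ε) p q)

_-_ : ℝ → ℝ → ℝ
x - y = x + (- y)

_*_ : ℝ → ℝ → ℝ
(x * y) .seq i  = seq x i ℚ.* seq y i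
(x * y) .cauchy = cauchy′
  where
  module X = Bounded (bounded x)
  module Y = Bounded (bounded y)

  cauchy′ : IsCauchy (λ i → seq x i ℚ.* seq y i)
  cauchy′ ε = K , λ {i} {j} p q →
    let a = seq x i ; b = seq y i ; c = seq x j ; d = seq y j in begin
    ℚ.∣ a ℚ.* b ℚ.- c ℚ.* d ∣
      ≡⟨ cong ℚ.∣_∣ (solve 4 (λ a b c d → a :* b :- c :* d := a :* (b :- d) :+ (a :- c) :* d) refl a b c d) ⟩
    ℚ.∣ a ℚ.* (b ℚ.- d) ℚ.+ (a ℚ.- c) ℚ.* d ∣
      ≤⟨ ℚ.∣p+q∣≤∣p∣+∣q∣ (a ℚ.* (b ℚ.- d)) ((a ℚ.- c) ℚ.* d) ⟩
    ℚ.∣ a ℚ.* (b ℚ.- d) ∣ ℚ.+ ℚ.∣ (a ℚ.- c) ℚ.* d ∣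
      ≡⟨ cong₂ ℚ._+_ (ℚ.∣p*q∣≡∣p∣*∣q∣ a (b ℚ.- d)) (ℚ.∣p*q∣≡∣p∣*∣q∣ (a ℚ.- c) d) ⟩
    ℚ.∣ a ∣ ℚ.* ℚ.∣ b ℚ.- d ∣ ℚ.+ ℚ.∣ a ℚ.- c ∣ ℚ.* ℚ.∣ d ∣
      ≤⟨ ℚ.+-mono-≤
           (*-mono-≤-nonNeg {{ℚ.∣-∣-nonNeg a}} {{η≥0}}
             (X.upper (x≤ p)) (proj₂ cy (cy≤ p) (cy≤ q)))
           (*-mono-≤-nonNeg {{ℚ.∣-∣-nonNeg (a ℚ.- c)}} {{ℚ.pos⇒nonNeg Y.bound {{Y.bound>0}}}}
             (proj₂ cx (cx≤ p) (cx≤ q)) (Y.upper (y≤ q))) ⟩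
    X.bound ℚ.* η ℚ.+ η ℚ.* Y.bound
      ≡⟨ solve 4 (λ A B e r → A :* (e :* r) :+ (e :* r) :* B := e :* ((A :+ B) :* r)) refl
           X.bound Y.bound ε (pos⁻¹ C) ⟩
    ε ℚ.* (C ℚ.* pos⁻¹ C)   ≡⟨ cong (ε ℚ.*_) (pos⁻¹-inverse C) ⟩
    ε ℚ.* 1ℚ                ≡⟨ ℚ.*-identityʳ ε ⟩
    ε ∎
    where
    open ℚ.≤-Reasoning
    C = X.bound ℚ.+ Y.bound
    instance
      C>0 : Positive C
      C>0 = ℚ.pos+pos⇒pos X.bound {{X.bound>0}} Y.bound {{Y.bound>0}}
    η = ε ℚ.* pos⁻¹ C
    instance
      η>0 : Positive η
      η>0 = ℚ.pos*pos⇒pos ε (pos⁻¹ C) {{pos⁻¹-pos C}}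
    η≥0 : ℚ.NonNegative η
    η≥0 = ℚ.pos⇒nonNeg η
    cx = cauchy x η
    cy = cauchy y η
    K₁ = X.from ℕ.⊔ Y.from
    K₂ = proj₁ cx ℕ.⊔ proj₁ cy
    K = K₁ ℕ.⊔ K₂
    x≤ : ∀ {i} → K ℕ.≤ i → X.from ℕ.≤ i
    x≤ p = ℕ.m⊔n≤o⇒m≤o X.from Y.from (ℕ.m⊔n≤o⇒m≤o K₁ K₂ p)
    y≤ : ∀ {i} → K ℕ.≤ i → Y.from ℕ.≤ i
    y≤ p = ℕ.m⊔n≤o⇒n≤o X.from Y.from (ℕ.m⊔n≤o⇒m≤o K₁ K₂ p)
    cx≤ : ∀ {i} → K ℕ.≤ i → proj₁ cx ℕ.≤ i
    cx≤ p = ℕ.m⊔n≤o⇒m≤o (proj₁ cx) (proj₁ cy) (ℕ.m⊔n≤o⇒n≤o K₁ K₂ p)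
    cy≤ : ∀ {i} → K ℕ.≤ i → proj₁ cy ℕ.≤ i
    cy≤ p = ℕ.m⊔n≤o⇒n≤o (proj₁ cx) (proj₁ cy) (ℕ.m⊔n≤o⇒n≤o K₁ K₂ p)

module Inverse (x : ℝ) (x>0 : Positiveᴿ x) where
  open Positiveᴿ x>0

  s : ℕ → ℚ
  s i = seq x (from ℕ.+ i)

  bound≤s : ∀ i → bound ℚ.≤ s i
  bound≤s i = lower (ℕ.m≤m+n from i)

  s>0 : ∀ i → Positive (s i)
  s>0 i = pos-≤ {{bound>0}} (bound≤s i)

  inv : ℕ → ℚ
  inv i = (ℚ.1/ s i) {{ℚ.pos⇒nonZero (s i) {{s>0 i}}}}

  cauchy′ : IsCauchy inv
  cauchy′ ε = proj₁ cx , λ {i} {j} p q →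
    let a = s i ; b = s j ; a⁻¹ = inv i ; b⁻¹ = inv j
        a⁻¹>0 : Positive a⁻¹
        a⁻¹>0 = pos⁻¹-pos a {{s>0 i}}
        b⁻¹>0 : Positive b⁻¹
        b⁻¹>0 = pos⁻¹-pos b {{s>0 j}}
        a⁻¹≥0 = ℚ.pos⇒nonNeg a⁻¹ {{a⁻¹>0}}
        b⁻¹≥0 = ℚ.pos⇒nonNeg b⁻¹ {{b⁻¹>0}}
    in begin
    ℚ.∣ a⁻¹ ℚ.- b⁻¹ ∣
      ≡⟨ cong ℚ.∣_∣ (cong₂ ℚ._-_ (sym (ℚ.*-identityʳ a⁻¹)) (sym (ℚ.*-identityʳ b⁻¹))) ⟩
    ℚ.∣ a⁻¹ ℚ.* 1ℚ ℚ.- b⁻¹ ℚ.* 1ℚ ∣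
      ≡⟨ cong ℚ.∣_∣ (cong₂ (λ u v → a⁻¹ ℚ.* u ℚ.- b⁻¹ ℚ.* v)
           (sym (pos⁻¹-inverse b {{s>0 j}})) (sym (pos⁻¹-inverse a {{s>0 i}}))) ⟩
    ℚ.∣ a⁻¹ ℚ.* (b ℚ.* b⁻¹) ℚ.- b⁻¹ ℚ.* (a ℚ.* a⁻¹) ∣
      ≡⟨ cong ℚ.∣_∣ (solve 4 (λ a b u v → u :* (b :* v) :- v :* (a :* u) := (b :- a) :* (u :* v)) refl
           a b a⁻¹ b⁻¹) ⟩
    ℚ.∣ (b ℚ.- a) ℚ.* (a⁻¹ ℚ.* b⁻¹) ∣
      ≡⟨ ℚ.∣p*q∣≡∣p∣*∣q∣ (b ℚ.- a) (a⁻¹ ℚ.* b⁻¹) ⟩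
    ℚ.∣ b ℚ.- a ∣ ℚ.* ℚ.∣ a⁻¹ ℚ.* b⁻¹ ∣
      ≡⟨ cong (ℚ.∣ b ℚ.- a ∣ ℚ.*_) (ℚ.0≤p⇒∣p∣≡p (ℚ.<⇒≤ (ℚ.positive⁻¹ (a⁻¹ ℚ.* b⁻¹)
           {{ℚ.pos*pos⇒pos a⁻¹ {{a⁻¹>0}} b⁻¹ {{b⁻¹>0}}}}))) ⟩
    ℚ.∣ b ℚ.- a ∣ ℚ.* (a⁻¹ ℚ.* b⁻¹)
      ≤⟨ *-mono-≤-nonNeg {{ℚ.∣-∣-nonNeg (b ℚ.- a)}} {{ℚ.pos⇒nonNeg (c⁻¹ ℚ.* c⁻¹)}}
           (proj₂ cx (ℕ.m≤n⇒m≤o+n from q) (ℕ.m≤n⇒m≤o+n from p))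
           (*-mono-≤-nonNeg {{a⁻¹≥0}} {{ℚ.pos⇒nonNeg c⁻¹}}
             (pos⁻¹-anti {{bound>0}} {{s>0 i}} (bound≤s i))
             (pos⁻¹-anti {{bound>0}} {{s>0 j}} (bound≤s j))) ⟩
    ε ℚ.* (bound ℚ.* bound) ℚ.* (c⁻¹ ℚ.* c⁻¹)
      ≡⟨ solve 3 (λ e c r → e :* (c :* c) :* (r :* r) := e :* ((c :* r) :* (c :* r))) refl ε bound c⁻¹ ⟩
    ε ℚ.* ((bound ℚ.* c⁻¹) ℚ.* (bound ℚ.* c⁻¹))
      ≡⟨ cong (λ u → ε ℚ.* (u ℚ.* u)) (pos⁻¹-inverse bound {{bound>0}}) ⟩
    ε ℚ.* (1ℚ ℚ.* 1ℚ)
      ≡⟨ ℚ.*-identityʳ ε ⟩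
    ε ∎
    where
    open ℚ.≤-Reasoning
    c⁻¹ = pos⁻¹ bound {{bound>0}}
    instance
      c⁻¹>0 : Positive c⁻¹
      c⁻¹>0 = pos⁻¹-pos bound {{bound>0}}
      c⁻²>0 : Positive (c⁻¹ ℚ.* c⁻¹)
      c⁻²>0 = ℚ.pos*pos⇒pos c⁻¹ c⁻¹
      c²>0 : Positive (bound ℚ.* bound)
      c²>0 = ℚ.pos*pos⇒pos bound {{bound>0}} bound {{bound>0}}
      η>0 : Positive (ε ℚ.* (bound ℚ.* bound))
      η>0 = ℚ.pos*pos⇒pos ε (bound ℚ.* bound)
    cx = cauchy x (ε ℚ.* (bound ℚ.* bound))

-- The sequence is shifted to the range where it is bounded away from zero,
-- which does not affect the limit.
1/_ : (x : ℝ) → {{Positiveᴿ x}} → ℝ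
(1/_ x {{x>0}}) .seq    = Inverse.inv x x>0
(1/_ x {{x>0}}) .cauchy = Inverse.cauchy′ x x>0

_÷_ : (x y : ℝ) → {{Positiveᴿ y}} → ℝ
x ÷ y = x * 1/ y

1/-positive : ∀ x {{x>0 : Positiveᴿ x}} → Positiveᴿ (1/ x)
1/-positive x {{x>0}} = record
  { bound   = pos⁻¹ B.bound {{B.bound>0}}
  ; bound>0 = pos⁻¹-pos B.bound {{B.bound>0}}
  ; from    = B.from
  ; lower   = λ {i} p →
      let n = X.from ℕ.+ i
          s>0 : Positive (seq x n)
          s>0 = pos-≤ {{X.bound>0}} (X.lower (ℕ.m≤m+n X.from i))
      in pos⁻¹-anti {{s>0}} {{B.bound>0}}
           (ℚ.≤-trans (p≤∣p∣ (seq x n)) (B.upper (ℕ.m≤n⇒m≤o+n X.from p)))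
  }
  where
  module X = Positiveᴿ x>0
  module B = Bounded (bounded x)

-- For k ≥ 1, ⌊root⌋ k N is the largest a with a ^ k ≤ N.
⌊root⌋ : ℕ → ℕ → ℕ
⌊root⌋ k zero    = 0
⌊root⌋ k (suc N) with suc (⌊root⌋ k N) ℕ.^ k ℕ.≤? suc N
... | yes _ = suc (⌊root⌋ k N)
... | no  _ = ⌊root⌋ k N

^-distribʳ-* : ∀ k m n → (m ℕ.* n) ℕ.^ k ≡ m ℕ.^ k ℕ.* n ℕ.^ k
^-distribʳ-* zero    m n = refl
^-distribʳ-* (suc k) m n = trans (cong (m ℕ.* n ℕ.*_) (^-distribʳ-* k m n))
  (interchange m n (m ℕ.^ k) (n ℕ.^ k))
  where
  interchange : ∀ a b c d → (a ℕ.* b) ℕ.* (c ℕ.* d) ≡ (a ℕ.* c) ℕ.* (b ℕ.* d)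
  interchange = ℕ-RingSolver.solve-∀

^-cancel-< : ∀ k {a b} → a ℕ.^ k ℕ.< b ℕ.^ k → a ℕ.< b
^-cancel-< k {a} {b} p = ℕ.≰⇒> λ b≤a → ℕ.<⇒≱ p (ℕ.^-monoˡ-≤ k b≤a)

frac-≤ : ∀ a i b j → a ℕ.* suc j ℕ.≤ b ℕ.* suc i → + a ℚ./ suc i ℚ.≤ + b ℚ./ suc j
frac-≤ a i b j p = ℚ.toℚᵘ-cancel-≤ (begin
  ℚ.toℚᵘ (+ a ℚ./ suc i)   ≃⟨ ℚ.toℚᵘ-fromℚᵘ (mkℚᵘ (+ a) i) ⟩
  mkℚᵘ (+ a) i             ≤⟨ ℚᵘ.*≤* (subst₂′ (ℤ.pos-* a (suc j)) (ℤ.pos-* b (suc i)) (ℤ.+≤+ p)) ⟩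
  mkℚᵘ (+ b) j             ≃⟨ ℚᵘ.≃-sym (ℚ.toℚᵘ-fromℚᵘ (mkℚᵘ (+ b) j)) ⟩
  ℚ.toℚᵘ (+ b ℚ./ suc j)   ∎)
  where
  open ℚᵘ.≤-Reasoning
  subst₂′ : ∀ {u v u′ v′ : ℤ} → u ≡ u′ → v ≡ v′ → u ℤ.≤ v → u′ ℤ.≤ v′
  subst₂′ refl refl q = q

frac-suc : ∀ a i → + suc a ℚ./ suc i ≡ + a ℚ./ suc i ℚ.+ + 1 ℚ./ suc i
frac-suc a i = ℚ.toℚᵘ-injective (begin
  ℚ.toℚᵘ (+ suc a ℚ./ suc i)                              ≈⟨ ℚ.toℚᵘ-fromℚᵘ (mkℚᵘ (+ suc a) i) ⟩
  mkℚᵘ (+ suc a) i                                        ≈⟨ ℚᵘ.*≡* (eq (+ a) (+ suc i)) ⟩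
  mkℚᵘ (+ a) i ℚᵘ.+ mkℚᵘ (+ 1) i                          ≈⟨ ℚᵘ.≃-sym (ℚᵘ.+-cong
                                                               (ℚ.toℚᵘ-fromℚᵘ (mkℚᵘ (+ a) i))
                                                               (ℚ.toℚᵘ-fromℚᵘ (mkℚᵘ (+ 1) i))) ⟩
  ℚ.toℚᵘ (+ a ℚ./ suc i) ℚᵘ.+ ℚ.toℚᵘ (+ 1 ℚ./ suc i)      ≈⟨ ℚᵘ.≃-sym (ℚ.toℚᵘ-homo-+ (+ a ℚ./ suc i) (+ 1 ℚ./ suc i)) ⟩
  ℚ.toℚᵘ (+ a ℚ./ suc i ℚ.+ + 1 ℚ./ suc i)                ∎)
  where
  open ℚᵘ.≃-Reasoning
  eq : ∀ a d → (+ 1 ℤ.+ a) ℤ.* (d ℤ.* d) ≡ (a ℤ.* d ℤ.+ + 1 ℤ.* d) ℤ.* d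
  eq = ℤ-RingSolver.solve-∀

1/n≤ε : ∀ ε .{{_ : Positive ε}} {i} → ℚ.denominator-1 ε ℕ.≤ i → + 1 ℚ./ suc i ℚ.≤ ε
1/n≤ε ε@(ℚ.mkℚ ℤ.+[1+ a ] d c) {i} d≤i =
  subst (+ 1 ℚ./ suc i ℚ.≤_) (ℚ.fromℚᵘ-toℚᵘ ε)
    (frac-≤ 1 i (suc a) d (ℕ.≤-trans (ℕ.≤-reflexive (ℕ.*-identityˡ (suc d)))
      (ℕ.≤-trans (s≤s d≤i) (ℕ.m≤n*m (suc i) (suc a)))))

module _ (k : ℕ) .{{_ : NonZero k}} where

  ⌊root⌋-lower : ∀ N → ⌊root⌋ k N ℕ.^ k ℕ.≤ N
  ⌊root⌋-lower zero = ℕ.≤-reflexive (0^ k)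
    where
    0^ : ∀ k .{{_ : NonZero k}} → 0 ℕ.^ k ≡ 0
    0^ (suc k) = refl
  ⌊root⌋-lower (suc N) with suc (⌊root⌋ k N) ℕ.^ k ℕ.≤? suc N
  ... | yes p = p
  ... | no  _ = ℕ.m≤n⇒m≤1+n (⌊root⌋-lower N)

  ⌊root⌋-upper : ∀ N → N ℕ.< suc (⌊root⌋ k N) ℕ.^ k
  ⌊root⌋-upper zero = ℕ.m^n>0 1 k
  ⌊root⌋-upper (suc N) with suc (⌊root⌋ k N) ℕ.^ k ℕ.≤? suc N
  ... | yes p = ℕ.≤-<-trans (⌊root⌋-upper N) (ℕ.^-monoˡ-< k (ℕ.n<1+n _))
  ... | no ¬p = ℕ.≰⇒> ¬p

  -- The largest fraction with denominator i + 1 whose k-th power is at most m.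
  rootSeq : ℕ → ℕ → ℚ
  rootSeq m i = + ⌊root⌋ k (m ℕ.* suc i ℕ.^ k) ℚ./ suc i

  rootSeq-≤ : ∀ m i j → rootSeq m i ℚ.≤ rootSeq m j ℚ.+ + 1 ℚ./ suc j
  rootSeq-≤ m i j = subst (rootSeq m i ℚ.≤_) (frac-suc b j)
    (frac-≤ a i (suc b) j (ℕ.<⇒≤ (^-cancel-< k (begin-strict
      (a ℕ.* e) ℕ.^ k             ≡⟨ ^-distribʳ-* k a e ⟩
      a ℕ.^ k ℕ.* e ℕ.^ k         ≤⟨ ℕ.*-monoˡ-≤ (e ℕ.^ k) (⌊root⌋-lower (m ℕ.* d ℕ.^ k)) ⟩
      m ℕ.* d ℕ.^ k ℕ.* e ℕ.^ k   ≡⟨ swap m (d ℕ.^ k) (e ℕ.^ k) ⟩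
      m ℕ.* e ℕ.^ k ℕ.* d ℕ.^ k   <⟨ ℕ.*-monoˡ-< (d ℕ.^ k) {{ℕ.m^n≢0 d k}} (⌊root⌋-upper (m ℕ.* e ℕ.^ k)) ⟩
      suc b ℕ.^ k ℕ.* d ℕ.^ k     ≡⟨ sym (^-distribʳ-* k (suc b) d) ⟩
      (suc b ℕ.* d) ℕ.^ k         ∎))))
    where
    open ℕ.≤-Reasoning
    d = suc i
    e = suc j
    a = ⌊root⌋ k (m ℕ.* d ℕ.^ k)
    b = ⌊root⌋ k (m ℕ.* e ℕ.^ k)
    swap : ∀ a b c → a ℕ.* b ℕ.* c ≡ a ℕ.* c ℕ.* b
    swap = ℕ-RingSolver.solve-∀

  root : ℕ → ℝ
  root m .seq    = rootSeq m
  root m .cauchy = λ ε → ℚ.denominator-1 ε , λ {i} {j} p q → ∣p-q∣≤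
    (ℚ.≤-trans (rootSeq-≤ m i j) (ℚ.+-monoʳ-≤ (rootSeq m j) (1/n≤ε ε q)))
    (ℚ.≤-trans (rootSeq-≤ m j i) (ℚ.+-monoʳ-≤ (rootSeq m i) (1/n≤ε ε p)))

  root-positive : ∀ m .{{_ : NonZero m}} → Positiveᴿ (root m)
  root-positive m = record
    { bound   = 1ℚ
    ; bound>0 = _
    ; from    = 0
    ; lower   = λ {i} _ → frac-≤ 1 0 (⌊root⌋ k (m ℕ.* suc i ℕ.^ k)) i (subst₂≤ i (ℕ.<⇒≤pred (^-cancel-< k (ℕ.≤-<-trans
        (ℕ.m≤n*m (suc i ℕ.^ k) m) (⌊root⌋-upper (m ℕ.* suc i ℕ.^ k))))))
    }
    where
    subst₂≤ : ∀ i {b} → suc i ℕ.≤ b → 1 ℕ.* suc i ℕ.≤ b ℕ.* 1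
    subst₂≤ i {b} p = ℕ.≤-trans (ℕ.≤-reflexive (ℕ.*-identityˡ (suc i)))
      (ℕ.≤-trans p (ℕ.≤-reflexive (sym (ℕ.*-identityʳ b))))

-- m to the power p / q is the q-th root of m ^ p, and m to the power - r is
-- the inverse of m to the power r.
pow : (m : ℕ) .{{_ : NonZero m}} → ℚᵘ → ℝ
pow m (mkℚᵘ (+ p)    q-1) = root (suc q-1) (m ℕ.^ p)
pow m (mkℚᵘ -[1+ p ] q-1) = 1/_ (root (suc q-1) (m ℕ.^ suc p))
  {{root-positive (suc q-1) (m ℕ.^ suc p) {{ℕ.m^n≢0 m (suc p)}}}}

pow-positive : ∀ m .{{_ : NonZero m}} r → Positiveᴿ (pow m r)
pow-positive m (mkℚᵘ (+ p)    q-1) = root-positive (suc q-1) (m ℕ.^ p) {{ℕ.m^n≢0 m p}}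
pow-positive m (mkℚᵘ -[1+ p ] q-1) = 1/-positive (root (suc q-1) (m ℕ.^ suc p))
  {{root-positive (suc q-1) (m ℕ.^ suc p) {{ℕ.m^n≢0 m (suc p)}}}}

-- The same real as pow m r; the copattern definition keeps m ^ r from reducing,
-- so that instance search can recover m and r from it.
infixr 9 _^_

_^_ : (m : ℕ) .{{_ : NonZero m}} → ℚᵘ → ℝ
(m ^ r) .seq    = pow m r .seq
(m ^ r) .cauchy = pow m r .cauchy

instance
  ^-positive : ∀ {m} .{m≢0 : NonZero m} {r} → Positiveᴿ (_^_ m {{m≢0}} r)
  ^-positive {m} {m≢0} {r} = record { Positiveᴿ (pow-positive m {{m≢0}} r) }

-- Put each vertex into a random set A independently with probability p, and let f be 2 on A,
-- 1 on the vertices outside the closed neighbourhood of A, and 0 elsewhere. This f is Roman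
-- dominating and, with q = 1 - p, has expected weight at most n (2 - 2q + q ^ (1 + δ)), which is
-- least at q = (2 / (1 + δ)) ^ (1 / δ). Only q ^ δ ≤ 2 / (1 + δ) is needed to bound it by
-- 2n (1 - q δ / (1 + δ)), so q may be taken rational, namely as a lower approximation a / d of
-- the optimum read off the integer parts of the roots in the theorem.
module Submission where

open import Defs
open import Data.Bool.Base using (Bool; true; false; if_then_else_)
open import Data.Fin.Base as Fin using (Fin; toℕ)
open import Data.Fin.Patterns using (0F; 1F; 2F)
open import Data.Fin.Subset using (Subset; inside; outside; ∣_∣; _∈_; _∪_; ⁅_⁆)
open import Data.Fin.Subset.Properties
  using (x∈⁅x⁆; x∈⁅y⁆⇒x≡y; x∈p∪q⁻; p⊆p∪q; q⊆p∪q; p⊂q⇒∣p∣<∣q∣)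
open import Data.Integer.Base as ℤ using (+_)
import Data.Integer.Properties as ℤ
import Data.Integer.Tactic.RingSolver as ℤ-RingSolver
open import Data.List.Base using (map; allFin)
open import Data.List.Extrema.Nat using (min≤xs)
open import Data.List.Membership.Propositional.Properties using (∈-map⁺; ∈-allFin)
import Data.List.Relation.Unary.All as All
open import Data.Nat.Base as ℕ using (ℕ; zero; suc; z≤n; s≤s; NonZero)
import Data.Nat.Properties as ℕ
open import Data.Nat.Tactic.RingSolver using (solve-∀)
open import Data.Product.Base using (∃; _×_; _,_)
open import Data.Rational.Base as ℚ using (ℚ; 1ℚ; Positive)
import Data.Rational.Properties as ℚ
open import Data.Rational.Solver using (module +-*-Solver)
open import Data.Rational.Unnormalised.Base as ℚᵘ using (mkℚᵘ; 1ℚᵘ; _/_)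
import Data.Rational.Unnormalised.Properties as ℚᵘ
open import Data.Sum.Base as Sum using (_⊎_; inj₁; inj₂; [_,_]′)
open import Data.Vec.Base using ([]; _∷_; lookup; here; there)
open import Data.Vec.Properties using ([]=⇒lookup; lookup∘tabulate)
open import Function.Base using (_∘_; const)
open import Relation.Binary.PropositionalEquality
  using (_≡_; refl; sym; trans; cong; cong₂; subst; subst₂; module ≡-Reasoning)
open import Relation.Nullary.Decidable using (yes; does)
open import Relation.Nullary.Negation using (contradiction)

import Algebra.Properties.CommutativeMonoid.Sum ℕ.+-0-commutativeMonoid as Σℕ

-- Finite sums and random subsets.

sum-mono-≤ : ∀ {n} {f g : Fin n → ℕ} → (∀ i → f i ℕ.≤ g i) → Σℕ.sum f ℕ.≤ Σℕ.sum g
sum-mono-≤ {zero}  f≤g = z≤n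
sum-mono-≤ {suc n} f≤g = ℕ.+-mono-≤ (f≤g 0F) (sum-mono-≤ (f≤g ∘ Fin.suc))

*-sum-≤ : ∀ {n} c m {f : Fin n → ℕ} → (∀ i → c ℕ.* f i ℕ.≤ m) → c ℕ.* Σℕ.sum f ℕ.≤ n ℕ.* m
*-sum-≤ {zero}  c m     cf≤m = ℕ.≤-reflexive (ℕ.*-zeroʳ c)
*-sum-≤ {suc n} c m {f} cf≤m = begin
  c ℕ.* (f 0F ℕ.+ Σℕ.sum (f ∘ Fin.suc))           ≡⟨ ℕ.*-distribˡ-+ c (f 0F) _ ⟩
  c ℕ.* f 0F ℕ.+ c ℕ.* Σℕ.sum (f ∘ Fin.suc)       ≤⟨ ℕ.+-mono-≤ (cf≤m 0F) (*-sum-≤ c m (cf≤m ∘ Fin.suc)) ⟩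
  m ℕ.+ n ℕ.* m                                   ∎
  where
  open ℕ.≤-Reasoning

-- The indicator of disjointness, valued in `ℕ` so that `𝔼` applies to it, with a recursion that
-- follows the coordinates as `𝔼` does.
misses : ∀ {n} → Subset n → Subset n → ℕ
misses []            []            = 1
misses (outside ∷ S) (_ ∷ A)       = misses S A
misses (inside ∷ S)  (outside ∷ A) = misses S A
misses (inside ∷ S)  (inside ∷ A)  = 0

-- `extend` branches on this sum: the left case carries the vertex that dominates, the right case
-- the equation that pays for the value 1.
meets⊎misses : ∀ {n} (S A : Subset n) → (∃ λ u → u ∈ S × u ∈ A) ⊎ misses S A ≡ 1
meets⊎misses []            []            = inj₂ refl
meets⊎misses (outside ∷ S) (_ ∷ A)       = Sum.map₁ (λ (u , p , q) → _ , there p , there q) (meets⊎misses S A)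
meets⊎misses (inside ∷ S)  (outside ∷ A) = Sum.map₁ (λ (u , p , q) → _ , there p , there q) (meets⊎misses S A)
meets⊎misses (inside ∷ S)  (inside ∷ A)  = inj₁ (0F , here , here)

-- 𝔼 F is (a + b) ^ n times the expectation of F over a random subset
-- containing each element independently with probability b / (a + b).
module Weighted (a b : ℕ) where

  d : ℕ
  d = a ℕ.+ b

  𝔼 : ∀ {n} → (Subset n → ℕ) → ℕ
  𝔼 {zero}  F = F []
  𝔼 {suc n} F = a ℕ.* 𝔼 (F ∘ (outside ∷_)) ℕ.+ b ℕ.* 𝔼 (F ∘ (inside ∷_))

  𝔼-mono : ∀ {n} {F G : Subset n → ℕ} → (∀ A → F A ℕ.≤ G A) → 𝔼 F ℕ.≤ 𝔼 G
  𝔼-mono {zero}  F≤G = F≤G []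
  𝔼-mono {suc n} F≤G = ℕ.+-mono-≤
    (ℕ.*-monoʳ-≤ a (𝔼-mono (F≤G ∘ (outside ∷_))))
    (ℕ.*-monoʳ-≤ b (𝔼-mono (F≤G ∘ (inside ∷_))))

  𝔼-const : ∀ {n} c → 𝔼 {n} (const c) ≡ d ℕ.^ n ℕ.* c
  𝔼-const {zero}  c = sym (ℕ.*-identityˡ c)
  𝔼-const {suc n} c rewrite 𝔼-const {n} c = lemma a b (d ℕ.^ n) c
    where
    lemma : ∀ a b w c → a ℕ.* (w ℕ.* c) ℕ.+ b ℕ.* (w ℕ.* c) ≡ (a ℕ.+ b) ℕ.* w ℕ.* c
    lemma = solve-∀

  𝔼-+ : ∀ {n} (F G : Subset n → ℕ) → 𝔼 (λ A → F A ℕ.+ G A) ≡ 𝔼 F ℕ.+ 𝔼 G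
  𝔼-+ {zero}  F G = refl
  𝔼-+ {suc n} F G
    rewrite 𝔼-+ (F ∘ (outside ∷_)) (G ∘ (outside ∷_)) | 𝔼-+ (F ∘ (inside ∷_)) (G ∘ (inside ∷_)) =
    lemma a b (𝔼 (F ∘ (outside ∷_))) (𝔼 (F ∘ (inside ∷_))) (𝔼 (G ∘ (outside ∷_))) (𝔼 (G ∘ (inside ∷_)))
    where
    lemma : ∀ a b f f′ g g′ →
      a ℕ.* (f ℕ.+ g) ℕ.+ b ℕ.* (f′ ℕ.+ g′) ≡ a ℕ.* f ℕ.+ b ℕ.* f′ ℕ.+ (a ℕ.* g ℕ.+ b ℕ.* g′)
    lemma = solve-∀

  𝔼-sum : ∀ {m n} (F : Fin m → Subset n → ℕ) → 𝔼 (λ A → Σℕ.sum (λ v → F v A)) ≡ Σℕ.sum (𝔼 ∘ F)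
  𝔼-sum {zero}  {n} F = trans (𝔼-const {n} 0) (ℕ.*-zeroʳ (d ℕ.^ n))
  𝔼-sum {suc m} F = trans (𝔼-+ (F 0F) _) (cong (𝔼 (F 0F) ℕ.+_) (𝔼-sum (F ∘ Fin.suc)))

  -- The marginal of one coordinate: every other coordinate contributes a factor `d`. The extra `d`
  -- on the left avoids the exponent `n - 1`.
  𝔼-lookup : ∀ {n} (h : Bool → ℕ) (v : Fin n) →
    d ℕ.* 𝔼 (λ A → h (lookup A v)) ≡ d ℕ.^ n ℕ.* (a ℕ.* h outside ℕ.+ b ℕ.* h inside)
  𝔼-lookup {suc n} h 0F
    rewrite 𝔼-const {n} (h outside) | 𝔼-const {n} (h inside) = lemma a b (d ℕ.^ n) (h outside) (h inside)
    where
    lemma : ∀ a b w x y → (a ℕ.+ b) ℕ.* (a ℕ.* (w ℕ.* x) ℕ.+ b ℕ.* (w ℕ.* y)) ≡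
      (a ℕ.+ b) ℕ.* w ℕ.* (a ℕ.* x ℕ.+ b ℕ.* y)
    lemma = solve-∀
  𝔼-lookup {suc n} h (Fin.suc v) = begin
    d ℕ.* (a ℕ.* e ℕ.+ b ℕ.* e)     ≡⟨ lemma a b e ⟩
    d ℕ.* (d ℕ.* e)                 ≡⟨ cong (d ℕ.*_) (𝔼-lookup h v) ⟩
    d ℕ.* (d ℕ.^ n ℕ.* _)           ≡⟨ ℕ.*-assoc d (d ℕ.^ n) _ ⟨
    d ℕ.* d ℕ.^ n ℕ.* _             ∎
    where
    open ≡-Reasoning
    e = 𝔼 (λ A → h (lookup A v))
    lemma : ∀ a b e → (a ℕ.+ b) ℕ.* (a ℕ.* e ℕ.+ b ℕ.* e) ≡ (a ℕ.+ b) ℕ.* ((a ℕ.+ b) ℕ.* e)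
    lemma = solve-∀

  -- Avoiding `S` forces each of its elements outside, so by independence `k` of them already give
  -- probability at most `(a / d) ^ k`. In the recursion a coordinate outside `S` yields a factor
  -- `d`, and one inside `S` only the factor `a`, as its other half vanishes.
  𝔼-misses : ∀ {n} k (S : Subset n) → k ℕ.≤ ∣ S ∣ → d ℕ.^ k ℕ.* 𝔼 (misses S) ℕ.≤ d ℕ.^ n ℕ.* a ℕ.^ k
  𝔼-misses zero [] k≤ = ℕ.≤-refl
  𝔼-misses {suc n} k (outside ∷ S) k≤ = begin
    d ℕ.^ k ℕ.* (a ℕ.* e ℕ.+ b ℕ.* e)     ≡⟨ lemma a b (d ℕ.^ k) e ⟩
    d ℕ.* (d ℕ.^ k ℕ.* e)                 ≤⟨ ℕ.*-monoʳ-≤ d (𝔼-misses k S k≤) ⟩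
    d ℕ.* (d ℕ.^ n ℕ.* a ℕ.^ k)           ≡⟨ ℕ.*-assoc d (d ℕ.^ n) _ ⟨
    d ℕ.* d ℕ.^ n ℕ.* a ℕ.^ k             ∎
    where
    open ℕ.≤-Reasoning
    e = 𝔼 (misses S)
    lemma : ∀ a b w e → w ℕ.* (a ℕ.* e ℕ.+ b ℕ.* e) ≡ (a ℕ.+ b) ℕ.* (w ℕ.* e)
    lemma = solve-∀
  -- All `k` factors are spent; the further elements of `S` are covered by the trivial bound 1.
  𝔼-misses {suc n} zero (inside ∷ S) k≤ = begin
    1 ℕ.* 𝔼 (misses (inside ∷ S))         ≡⟨ ℕ.*-identityˡ _ ⟩
    𝔼 (misses (inside ∷ S))               ≤⟨ 𝔼-mono (misses≤1 (inside ∷ S)) ⟩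
    𝔼 {suc n} (const 1)                   ≡⟨ 𝔼-const {suc n} 1 ⟩
    d ℕ.^ suc n ℕ.* 1                     ∎
    where
    open ℕ.≤-Reasoning
    misses≤1 : ∀ {n} (S A : Subset n) → misses S A ℕ.≤ 1
    misses≤1 []            []            = ℕ.≤-refl
    misses≤1 (outside ∷ S) (_ ∷ A)       = misses≤1 S A
    misses≤1 (inside ∷ S)  (outside ∷ A) = misses≤1 S A
    misses≤1 (inside ∷ S)  (inside ∷ A)  = z≤n
  𝔼-misses {suc n} (suc k) (inside ∷ S) (s≤s k≤) = begin
    d ℕ.* d ℕ.^ k ℕ.* (a ℕ.* e ℕ.+ b ℕ.* 𝔼 {n} (const 0))
      ≡⟨ cong (λ z → d ℕ.* d ℕ.^ k ℕ.* (a ℕ.* e ℕ.+ b ℕ.* z)) (trans (𝔼-const {n} 0) (ℕ.*-zeroʳ (d ℕ.^ n))) ⟩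
    d ℕ.* d ℕ.^ k ℕ.* (a ℕ.* e ℕ.+ b ℕ.* 0)     ≡⟨ lemma d a b (d ℕ.^ k) e ⟩
    d ℕ.* a ℕ.* (d ℕ.^ k ℕ.* e)                 ≤⟨ ℕ.*-monoʳ-≤ (d ℕ.* a) (𝔼-misses k S k≤) ⟩
    d ℕ.* a ℕ.* (d ℕ.^ n ℕ.* a ℕ.^ k)           ≡⟨ interchange d a (d ℕ.^ n) (a ℕ.^ k) ⟩
    d ℕ.* d ℕ.^ n ℕ.* (a ℕ.* a ℕ.^ k)           ∎
    where
    open ℕ.≤-Reasoning
    e = 𝔼 (misses S)
    lemma : ∀ d a b w e → d ℕ.* w ℕ.* (a ℕ.* e ℕ.+ b ℕ.* 0) ≡ d ℕ.* a ℕ.* (w ℕ.* e)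
    lemma = solve-∀
    interchange : ∀ d a v w → d ℕ.* a ℕ.* (v ℕ.* w) ≡ d ℕ.* v ℕ.* (a ℕ.* w)
    interchange = solve-∀

-- Roman dominating functions from random vertex sets.

-- As `k ≥ 1`, the factor `suc k` is at least 2, which leaves `a ^ k ≤ d ^ k`. This makes
-- `b = d - a` available as a natural weight.
ratio≤1 : ∀ a d k .{{_ : NonZero k}} → suc k ℕ.* a ℕ.^ k ℕ.≤ 2 ℕ.* d ℕ.^ k → a ℕ.≤ d
ratio≤1 a d k aᵏ≤ = ℕ.≮⇒≥ λ d<a → ℕ.<⇒≱ (ℕ.^-monoˡ-< k d<a) (ℕ.*-cancelˡ-≤ 2
  (ℕ.≤-trans (ℕ.*-monoˡ-≤ (a ℕ.^ k) (s≤s (ℕ.>-nonZero⁻¹ k))) aᵏ≤))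

minDegree≤degree : ∀ {n} .{{_ : NonZero n}} (G : Graph n) v → minDegree G ℕ.≤ degree G v
minDegree≤degree {suc n} G v =
  All.lookup (min≤xs _ (map (degree G) (allFin (suc n)))) (∈-map⁺ (degree G) (∈-allFin v))

module _ {n : ℕ} (G : Graph n) where
  open Graph G

  ∈-neighbours⁻ : ∀ {u v} → u ∈ neighbours G v → Adj v u
  ∈-neighbours⁻ {u} {v} u∈ with adj? v u | trans (sym (lookup∘tabulate (does ∘ adj? v) u)) ([]=⇒lookup u∈)
  ... | yes vu | _ = vu

  closedNeighbours : Fin n → Subset n
  closedNeighbours v = ⁅ v ⁆ ∪ neighbours G v

  -- Strict because there are no loops; this one extra element raises the exponent from `k` to
  -- `suc k`.
  degree<∣closedNeighbours∣ : ∀ v → degree G v ℕ.< ∣ closedNeighbours v ∣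
  degree<∣closedNeighbours∣ v = p⊂q⇒∣p∣<∣q∣
    (q⊆p∪q ⁅ v ⁆ (neighbours G v) , v , p⊆p∪q (neighbours G v) (x∈⁅x⁆ v) , irrefl ∘ ∈-neighbours⁻)

  extend : Subset n → Fin n → Fin 3
  extend A v = if lookup A v then 2F else [ const 0F , const 1F ]′ (meets⊎misses (closedNeighbours v) A)

  extend-isRomanDominating : ∀ A → IsRomanDominating G (extend A)
  extend-isRomanDominating A v fv≡0 with lookup A v in v∉A | meets⊎misses (closedNeighbours v) A
  ... | false | inj₁ (u , u∈N , u∈A) with x∈p∪q⁻ ⁅ v ⁆ (neighbours G v) u∈N
  ...   | inj₂ u∈Nv = u , ∈-neighbours⁻ u∈Nv ,
    cong (if_then 2F else [ const 0F , const 1F ]′ (meets⊎misses (closedNeighbours u) A)) ([]=⇒lookup u∈A)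
  -- In this branch `v` is not in `A`, so the vertex found in the closed neighbourhood cannot be `v`
  -- itself.
  ...   | inj₁ u∈v with refl ← x∈⁅y⁆⇒x≡y v u∈v = contradiction (trans (sym ([]=⇒lookup u∈A)) v∉A) λ ()

  -- Splits the weight at `v` into two terms whose expectations are handled separately by `𝔼-lookup`
  -- and `𝔼-misses`.
  extend-≤ : ∀ A v → toℕ (extend A v) ℕ.≤ (if lookup A v then 2 else 0) ℕ.+ misses (closedNeighbours v) A
  extend-≤ A v with lookup A v | meets⊎misses (closedNeighbours v) A
  ... | true  | _         = ℕ.m≤m+n 2 _
  ... | false | inj₁ _    = z≤n
  ... | false | inj₂ eq   = ℕ.≤-reflexive (sym eq)

  -- For p = b / (a + b) this is γR ≤ n (2p + (1 - p) ^ (1 + k)).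
  γR-≤ : ∀ a b k .{{_ : NonZero (a ℕ.+ b)}} → (∀ v → k ℕ.≤ degree G v) →
    (a ℕ.+ b) ℕ.^ suc k ℕ.* γR G ℕ.≤ n ℕ.* (2 ℕ.* b ℕ.* (a ℕ.+ b) ℕ.^ k ℕ.+ a ℕ.^ suc k)
  γR-≤ a b k k≤deg = ℕ.*-cancelˡ-≤ (d ℕ.^ n) {{ℕ.m^n≢0 d n}} (begin
    d ℕ.^ n ℕ.* (d ℕ.^ suc k ℕ.* γR G)          ≡⟨ swap (d ℕ.^ n) (d ℕ.^ suc k) (γR G) ⟩
    d ℕ.^ suc k ℕ.* (d ℕ.^ n ℕ.* γR G)          ≡⟨ cong (d ℕ.^ suc k ℕ.*_) (𝔼-const {n} (γR G)) ⟨
    -- The averaging argument: `γR G` is at most the weight of every `extend A`, hence at most the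
    -- mean.
    d ℕ.^ suc k ℕ.* 𝔼 {n} (const (γR G))        ≤⟨ ℕ.*-monoʳ-≤ (d ℕ.^ suc k) (𝔼-mono λ A →
                                                    ℕ.≤-trans (γR-minimal G (extend A) (extend-isRomanDominating A))
                                                      (sum-mono-≤ (extend-≤ A))) ⟩
    d ℕ.^ suc k ℕ.* 𝔼 (λ A → Σℕ.sum (λ v → cost v A))
                                                ≡⟨ cong (d ℕ.^ suc k ℕ.*_) (𝔼-sum cost) ⟩
    d ℕ.^ suc k ℕ.* Σℕ.sum (𝔼 ∘ cost)           ≤⟨ *-sum-≤ (d ℕ.^ suc k) _ 𝔼-cost ⟩
    n ℕ.* (d ℕ.^ n ℕ.* (2 ℕ.* b ℕ.* d ℕ.^ k ℕ.+ a ℕ.^ suc k))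
                                                ≡⟨ swap n (d ℕ.^ n) _ ⟩
    d ℕ.^ n ℕ.* (n ℕ.* (2 ℕ.* b ℕ.* d ℕ.^ k ℕ.+ a ℕ.^ suc k))
                                                ∎)
    where
    open ℕ.≤-Reasoning
    open Weighted a b
    swap : ∀ x y z → x ℕ.* (y ℕ.* z) ≡ y ℕ.* (x ℕ.* z)
    swap = solve-∀

    chosen : Fin n → Subset n → ℕ
    chosen v A = if lookup A v then 2 else 0
    cost : Fin n → Subset n → ℕ
    cost v A = chosen v A ℕ.+ misses (closedNeighbours v) A

    𝔼-cost : ∀ v → d ℕ.^ suc k ℕ.* 𝔼 (cost v) ℕ.≤ d ℕ.^ n ℕ.* (2 ℕ.* b ℕ.* d ℕ.^ k ℕ.+ a ℕ.^ suc k)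
    𝔼-cost v = begin
      d ℕ.* d ℕ.^ k ℕ.* 𝔼 (cost v)
        ≡⟨ cong (d ℕ.* d ℕ.^ k ℕ.*_) (𝔼-+ (chosen v) (misses (closedNeighbours v))) ⟩
      d ℕ.* d ℕ.^ k ℕ.* (𝔼 (chosen v) ℕ.+ 𝔼 (misses (closedNeighbours v)))
        ≡⟨ regroup d (d ℕ.^ k) (𝔼 (chosen v)) (𝔼 (misses (closedNeighbours v))) ⟩
      d ℕ.^ k ℕ.* (d ℕ.* 𝔼 (chosen v)) ℕ.+ d ℕ.^ suc k ℕ.* 𝔼 (misses (closedNeighbours v))
        ≤⟨ ℕ.+-mono-≤
             (ℕ.≤-reflexive (cong (d ℕ.^ k ℕ.*_) (𝔼-lookup (if_then 2 else 0) v)))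
             (𝔼-misses (suc k) (closedNeighbours v) (ℕ.≤-<-trans (k≤deg v) (degree<∣closedNeighbours∣ v))) ⟩
      d ℕ.^ k ℕ.* (d ℕ.^ n ℕ.* (a ℕ.* 0 ℕ.+ b ℕ.* 2)) ℕ.+ d ℕ.^ n ℕ.* a ℕ.^ suc k
        ≡⟨ collect (d ℕ.^ k) (d ℕ.^ n) a b (a ℕ.^ suc k) ⟩
      d ℕ.^ n ℕ.* (2 ℕ.* b ℕ.* d ℕ.^ k ℕ.+ a ℕ.^ suc k) ∎
      where
      regroup : ∀ d w x y → d ℕ.* w ℕ.* (x ℕ.+ y) ≡ w ℕ.* (d ℕ.* x) ℕ.+ d ℕ.* w ℕ.* y
      regroup = solve-∀
      collect : ∀ w v a b c →
        w ℕ.* (v ℕ.* (a ℕ.* 0 ℕ.+ b ℕ.* 2)) ℕ.+ v ℕ.* c ≡ v ℕ.* (2 ℕ.* b ℕ.* w ℕ.+ c)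
      collect = solve-∀

  -- For a / d = q this is γR ≤ n (2 - 2q + q ^ (1 + k)) with q ^ k ≤ 2 / (1 + k).
  γR-≤-ratio : ∀ a d k .{{_ : NonZero k}} .{{_ : NonZero d}} → (∀ v → k ℕ.≤ degree G v) →
    suc k ℕ.* a ℕ.^ k ℕ.≤ 2 ℕ.* d ℕ.^ k →
    suc k ℕ.* d ℕ.* γR G ℕ.+ 2 ℕ.* n ℕ.* k ℕ.* a ℕ.≤ 2 ℕ.* n ℕ.* (suc k ℕ.* d)
  γR-≤-ratio a d k k≤deg aᵏ≤ with b , refl ← ℕ.m≤n⇒∃[o]m+o≡n (ratio≤1 a d k aᵏ≤) =
    ℕ.*-cancelˡ-≤ (d ℕ.^ k) {{ℕ.m^n≢0 d k}} (begin
    d ℕ.^ k ℕ.* (suc k ℕ.* d ℕ.* γR G ℕ.+ 2 ℕ.* n ℕ.* k ℕ.* a)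
      ≡⟨ e₁ (d ℕ.^ k) k d (γR G) n a ⟩
    suc k ℕ.* (d ℕ.^ suc k ℕ.* γR G) ℕ.+ 2 ℕ.* n ℕ.* k ℕ.* a ℕ.* d ℕ.^ k
      ≤⟨ ℕ.+-monoˡ-≤ _ (ℕ.*-monoʳ-≤ (suc k) (γR-≤ a b k k≤deg)) ⟩
    suc k ℕ.* (n ℕ.* (2 ℕ.* b ℕ.* d ℕ.^ k ℕ.+ a ℕ.^ suc k)) ℕ.+ 2 ℕ.* n ℕ.* k ℕ.* a ℕ.* d ℕ.^ k
      ≡⟨ e₂ (d ℕ.^ k) k b n a (a ℕ.^ k) ⟩
    2 ℕ.* n ℕ.* d ℕ.^ k ℕ.* (suc k ℕ.* b ℕ.+ k ℕ.* a) ℕ.+ n ℕ.* a ℕ.* (suc k ℕ.* a ℕ.^ k)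
      -- With `q = a / d`, this is `q ^ (1 + k) = q * q ^ k ≤ 2q / (1 + k)`, which makes the bound
      -- linear in `q`.
      ≤⟨ ℕ.+-monoʳ-≤ (2 ℕ.* n ℕ.* d ℕ.^ k ℕ.* (suc k ℕ.* b ℕ.+ k ℕ.* a)) (ℕ.*-monoʳ-≤ (n ℕ.* a) aᵏ≤) ⟩
    2 ℕ.* n ℕ.* d ℕ.^ k ℕ.* (suc k ℕ.* b ℕ.+ k ℕ.* a) ℕ.+ n ℕ.* a ℕ.* (2 ℕ.* d ℕ.^ k)
      ≡⟨ e₃ (d ℕ.^ k) k b n a ⟩
    d ℕ.^ k ℕ.* (2 ℕ.* n ℕ.* (suc k ℕ.* d)) ∎)
    where
    open ℕ.≤-Reasoning
    e₁ : ∀ w k d g n a → w ℕ.* ((1 ℕ.+ k) ℕ.* d ℕ.* g ℕ.+ 2 ℕ.* n ℕ.* k ℕ.* a) ≡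
      (1 ℕ.+ k) ℕ.* (d ℕ.* w ℕ.* g) ℕ.+ 2 ℕ.* n ℕ.* k ℕ.* a ℕ.* w
    e₁ = solve-∀
    e₂ : ∀ w k b n a v → (1 ℕ.+ k) ℕ.* (n ℕ.* (2 ℕ.* b ℕ.* w ℕ.+ a ℕ.* v)) ℕ.+ 2 ℕ.* n ℕ.* k ℕ.* a ℕ.* w ≡
      2 ℕ.* n ℕ.* w ℕ.* ((1 ℕ.+ k) ℕ.* b ℕ.+ k ℕ.* a) ℕ.+ n ℕ.* a ℕ.* ((1 ℕ.+ k) ℕ.* v)
    e₂ = solve-∀
    e₃ : ∀ w k b n a → 2 ℕ.* n ℕ.* w ℕ.* ((1 ℕ.+ k) ℕ.* b ℕ.+ k ℕ.* a) ℕ.+ n ℕ.* a ℕ.* (2 ℕ.* w) ≡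
      w ℕ.* (2 ℕ.* n ℕ.* ((1 ℕ.+ k) ℕ.* (a ℕ.+ b)))
    e₃ = solve-∀

  -- Here x / e approximates 2 ^ (1 / k) from below and (1 + y) / e bounds
  -- (1 + k) ^ (1 + 1 / k) from above; replacing 1 + y by y costs the last summand.
  γR-≤-roots : ∀ e x y k .{{_ : NonZero k}} → (∀ v → k ℕ.≤ degree G v) →
    x ℕ.^ k ℕ.≤ 2 ℕ.* e ℕ.^ k → suc k ℕ.^ suc k ℕ.* e ℕ.^ k ℕ.≤ suc y ℕ.^ k →
    γR G ℕ.* y ℕ.+ 2 ℕ.* (n ℕ.* (k ℕ.* x)) ℕ.≤ 2 ℕ.* (n ℕ.* y) ℕ.+ 2 ℕ.* (n ℕ.* 1)
  γR-≤-roots e x y k k≤deg xᵏ≤ ≤yᵏ = begin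
    γR G ℕ.* y ℕ.+ 2 ℕ.* (n ℕ.* (k ℕ.* x))
      ≤⟨ ℕ.+-monoˡ-≤ _ (ℕ.*-monoʳ-≤ (γR G) (ℕ.n≤1+n y)) ⟩
    γR G ℕ.* suc y ℕ.+ 2 ℕ.* (n ℕ.* (k ℕ.* x))
      -- The choice is `q = (1 + k) x / (1 + y)`, because the optimum `(2 / (1 + k)) ^ (1 / k)` is
      -- `1 + k` times the quotient of the two roots. The common factor `suc k` then cancels.
      ≤⟨ ℕ.*-cancelˡ-≤ (suc k) (subst₂ ℕ._≤_ (e₁ k (suc y) (γR G) n x) (e₂ k n y)
           (γR-≤-ratio (suc k ℕ.* x) (suc y) k k≤deg ratio)) ⟩
    2 ℕ.* (n ℕ.* y) ℕ.+ 2 ℕ.* (n ℕ.* 1) ∎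
    where
    open ℕ.≤-Reasoning
    e₁ : ∀ k d g n x → (1 ℕ.+ k) ℕ.* d ℕ.* g ℕ.+ 2 ℕ.* n ℕ.* k ℕ.* ((1 ℕ.+ k) ℕ.* x) ≡
      (1 ℕ.+ k) ℕ.* (g ℕ.* d ℕ.+ 2 ℕ.* (n ℕ.* (k ℕ.* x)))
    e₁ = solve-∀
    e₂ : ∀ k n y → 2 ℕ.* n ℕ.* ((1 ℕ.+ k) ℕ.* (1 ℕ.+ y)) ≡
      (1 ℕ.+ k) ℕ.* (2 ℕ.* (n ℕ.* y) ℕ.+ 2 ℕ.* (n ℕ.* 1))
    e₂ = solve-∀
    swap : ∀ u v → u ℕ.* (2 ℕ.* v) ≡ 2 ℕ.* (u ℕ.* v)
    swap = solve-∀
    ratio : suc k ℕ.* (suc k ℕ.* x) ℕ.^ k ℕ.≤ 2 ℕ.* suc y ℕ.^ k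
    ratio = begin
      suc k ℕ.* (suc k ℕ.* x) ℕ.^ k           ≡⟨ cong (suc k ℕ.*_) (^-distribʳ-* k (suc k) x) ⟩
      suc k ℕ.* (suc k ℕ.^ k ℕ.* x ℕ.^ k)     ≡⟨ ℕ.*-assoc (suc k) (suc k ℕ.^ k) (x ℕ.^ k) ⟨
      suc k ℕ.^ suc k ℕ.* x ℕ.^ k             ≤⟨ ℕ.*-monoʳ-≤ (suc k ℕ.^ suc k) xᵏ≤ ⟩
      suc k ℕ.^ suc k ℕ.* (2 ℕ.* e ℕ.^ k)     ≡⟨ swap (suc k ℕ.^ suc k) (e ℕ.^ k) ⟩
      2 ℕ.* (suc k ℕ.^ suc k ℕ.* e ℕ.^ k)     ≤⟨ ℕ.*-monoʳ-≤ 2 ≤yᵏ ⟩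
      2 ℕ.* suc y ℕ.^ k                       ∎

-- From natural numbers to rational approximations.

frac-+ : ∀ a b i → + (a ℕ.+ b) ℚ./ suc i ≡ + a ℚ./ suc i ℚ.+ + b ℚ./ suc i
frac-+ a b i = ℚ.toℚᵘ-injective (begin
  ℚ.toℚᵘ (+ (a ℕ.+ b) ℚ./ suc i)                        ≈⟨ ℚ.toℚᵘ-fromℚᵘ (mkℚᵘ (+ (a ℕ.+ b)) i) ⟩
  mkℚᵘ (+ (a ℕ.+ b)) i                                  ≈⟨ ℚᵘ.*≡* (trans (cong (ℤ._* (+ suc i ℤ.* + suc i)) (ℤ.pos-+ a b)) (eq (+ a) (+ b) (+ suc i))) ⟩
  mkℚᵘ (+ a) i ℚᵘ.+ mkℚᵘ (+ b) i                        ≈⟨ ℚᵘ.+-cong (ℚ.toℚᵘ-fromℚᵘ (mkℚᵘ (+ a) i))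
                                                             (ℚ.toℚᵘ-fromℚᵘ (mkℚᵘ (+ b) i)) ⟨
  ℚ.toℚᵘ (+ a ℚ./ suc i) ℚᵘ.+ ℚ.toℚᵘ (+ b ℚ./ suc i)    ≈⟨ ℚ.toℚᵘ-homo-+ (+ a ℚ./ suc i) (+ b ℚ./ suc i) ⟨
  ℚ.toℚᵘ (+ a ℚ./ suc i ℚ.+ + b ℚ./ suc i)              ∎)
  where
  open ℚᵘ.≃-Reasoning
  eq : ∀ a b d → (a ℤ.+ b) ℤ.* (d ℤ.* d) ≡ (a ℤ.* d ℤ.+ b ℤ.* d) ℤ.* d
  eq = ℤ-RingSolver.solve-∀

frac-* : ∀ a b i → + (a ℕ.* b) ℚ./ suc i ≡ + a ℚ./ 1 ℚ.* (+ b ℚ./ suc i)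
frac-* a b i = ℚ.toℚᵘ-injective (begin
  ℚ.toℚᵘ (+ (a ℕ.* b) ℚ./ suc i)                  ≈⟨ ℚ.toℚᵘ-fromℚᵘ (mkℚᵘ (+ (a ℕ.* b)) i) ⟩
  mkℚᵘ (+ (a ℕ.* b)) i                            ≈⟨ ℚᵘ.*≡* (cong₂ ℤ._*_ (ℤ.pos-* a b)
                                                       (cong (+_ ∘ suc) (ℕ.+-identityʳ i))) ⟩
  mkℚᵘ (+ a) 0 ℚᵘ.* mkℚᵘ (+ b) i                  ≈⟨ ℚᵘ.*-cong (ℚ.toℚᵘ-fromℚᵘ (mkℚᵘ (+ a) 0))
                                                       (ℚ.toℚᵘ-fromℚᵘ (mkℚᵘ (+ b) i)) ⟨
  ℚ.toℚᵘ (+ a ℚ./ 1) ℚᵘ.* ℚ.toℚᵘ (+ b ℚ./ suc i)  ≈⟨ ℚ.toℚᵘ-homo-* (+ a ℚ./ 1) (+ b ℚ./ suc i) ⟨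
  ℚ.toℚᵘ (+ a ℚ./ 1 ℚ.* (+ b ℚ./ suc i))          ∎)
  where open ℚᵘ.≃-Reasoning

private
  ι : ℕ → ℚ
  ι m = + m ℚ./ 1

-- After division by `suc i`, the integer parts `x` and `y` become the terms at index `i` of the two
-- root sequences, and the slack becomes a multiple of `1 / suc i`.
divide-through : ∀ g n k x y i →
  g ℕ.* y ℕ.+ 2 ℕ.* (n ℕ.* (k ℕ.* x)) ℕ.≤ 2 ℕ.* (n ℕ.* y) ℕ.+ 2 ℕ.* (n ℕ.* 1) →
  ι g ℚ.* (+ y ℚ./ suc i) ℚ.+ ι 2 ℚ.* (ι n ℚ.* (ι k ℚ.* (+ x ℚ./ suc i))) ℚ.≤
  ι 2 ℚ.* (ι n ℚ.* (+ y ℚ./ suc i)) ℚ.+ ι 2 ℚ.* (ι n ℚ.* (+ 1 ℚ./ suc i))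
divide-through g n k x y i h = subst₂ ℚ._≤_
  (trans (frac-+ (g ℕ.* y) (2 ℕ.* (n ℕ.* (k ℕ.* x))) i) (cong₂ ℚ._+_ (frac-* g y i)
    (trans (frac-*₂ (k ℕ.* x)) (cong (λ z → ι 2 ℚ.* (ι n ℚ.* z)) (frac-* k x i)))))
  (trans (frac-+ (2 ℕ.* (n ℕ.* y)) (2 ℕ.* (n ℕ.* 1)) i) (cong₂ ℚ._+_ (frac-*₂ y) (frac-*₂ 1)))
  (frac-≤ (g ℕ.* y ℕ.+ 2 ℕ.* (n ℕ.* (k ℕ.* x))) i (2 ℕ.* (n ℕ.* y) ℕ.+ 2 ℕ.* (n ℕ.* 1)) i
    (ℕ.*-monoˡ-≤ (suc i) h))
  where
  frac-*₂ : ∀ m → + (2 ℕ.* (n ℕ.* m)) ℚ./ suc i ≡ ι 2 ℚ.* (ι n ℚ.* (+ m ℚ./ suc i))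
  frac-*₂ m = trans (frac-* 2 (n ℕ.* m) i) (cong (ι 2 ℚ.*_) (frac-* n m i))

-- Multiply by the inverse of `y`; since `1 ≤ y`, the error term does not grow. The right-hand side
-- has the shape to which a term of the real bound unfolds.
solve-for-g : ∀ c g n k x y t ε .{{_ : ℚ.NonNegative (c ℚ.* (n ℚ.* t))}} .{{_ : Positive y}} → 1ℚ ℚ.≤ y →
  g ℚ.* y ℚ.+ c ℚ.* (n ℚ.* (k ℚ.* x)) ℚ.≤ c ℚ.* (n ℚ.* y) ℚ.+ c ℚ.* (n ℚ.* t) →
  c ℚ.* (n ℚ.* t) ℚ.≤ ε →
  g ℚ.≤ c ℚ.* (1ℚ ℚ.+ ℚ.- (x ℚ.* k ℚ.* pos⁻¹ y)) ℚ.* n ℚ.+ ε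
solve-for-g c g n k x y t ε 1≤y h cnt≤ε = begin
  g
    ≡⟨ ℚ.*-identityʳ g ⟨
  g ℚ.* 1ℚ
    ≡⟨ cong (g ℚ.*_) (pos⁻¹-inverse y) ⟨
  g ℚ.* (y ℚ.* r)
    ≡⟨ solve 4 (λ g y w r → g :* (y :* r) := (g :* y :+ w) :* r :+ :- (w :* r)) refl g y w r ⟩
  (g ℚ.* y ℚ.+ w) ℚ.* r ℚ.+ ℚ.- (w ℚ.* r)
    ≤⟨ ℚ.+-monoˡ-≤ (ℚ.- (w ℚ.* r)) (ℚ.*-monoʳ-≤-nonNeg r h) ⟩
  (c ℚ.* (n ℚ.* y) ℚ.+ c ℚ.* (n ℚ.* t)) ℚ.* r ℚ.+ ℚ.- (w ℚ.* r)
    ≡⟨ solve 7 (λ c n k x y r v → (c :* (n :* y) :+ v) :* r :+ :- (c :* (n :* (k :* x)) :* r) :=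
         c :* ((y :* r) :+ :- (x :* k :* r)) :* n :+ v :* r) refl c n k x y r (c ℚ.* (n ℚ.* t)) ⟩
  c ℚ.* (y ℚ.* r ℚ.+ ℚ.- (x ℚ.* k ℚ.* r)) ℚ.* n ℚ.+ c ℚ.* (n ℚ.* t) ℚ.* r
    ≡⟨ cong (λ z → c ℚ.* (z ℚ.+ ℚ.- (x ℚ.* k ℚ.* r)) ℚ.* n ℚ.+ c ℚ.* (n ℚ.* t) ℚ.* r) (pos⁻¹-inverse y) ⟩
  c ℚ.* (1ℚ ℚ.+ ℚ.- (x ℚ.* k ℚ.* r)) ℚ.* n ℚ.+ c ℚ.* (n ℚ.* t) ℚ.* r
    ≤⟨ ℚ.+-monoʳ-≤ main (ℚ.≤-trans
         (ℚ.*-monoˡ-≤-nonNeg (c ℚ.* (n ℚ.* t)) (pos⁻¹-anti {1ℚ} 1≤y))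
         (ℚ.≤-trans (ℚ.≤-reflexive (ℚ.*-identityʳ _)) cnt≤ε)) ⟩
  c ℚ.* (1ℚ ℚ.+ ℚ.- (x ℚ.* k ℚ.* r)) ℚ.* n ℚ.+ ε ∎
  where
  open ℚ.≤-Reasoning
  open +-*-Solver
  r = pos⁻¹ y
  w = c ℚ.* (n ℚ.* (k ℚ.* x))
  main = c ℚ.* (1ℚ ℚ.+ ℚ.- (x ℚ.* k ℚ.* r)) ℚ.* n
  instance _ = ℚ.pos⇒nonNeg r {{pos⁻¹-pos y}}

-- The bound in the reals.

theorem12 : ∀ {n} .{{_ : NonZero n}} (G : Graph n) (δ : ℕ) .{{_ : NonZero δ}} → minDegree G ≡ δ →
    fromℕ (γR G) ≤ fromℕ 2 * (fromℕ 1 - (2 ^ (+ 1 / δ) * fromℕ δ) ÷ ((1 ℕ.+ δ) ^ (1ℚᵘ ℚᵘ.+ + 1 / δ))) * fromℕ n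
theorem12 {n@(suc _)} G δ@(suc j) minDeg≡δ ε = ℚ.denominator-1 η , λ {i} N≤i →
  let t = + 1 ℚ./ suc i
      instance
        -- `root-positive` starts at index 0, so the inverse is not shifted and both roots are taken
        -- at the same `i`. Its lower bound 1 supplies `1 ≤ y` below.
        y>0 = Inverse.s>0 denom (^-positive {suc δ} {r = 1ℚᵘ ℚᵘ.+ + 1 / δ}) i
        t>0 = ℚ.normalize-pos 1 (suc i)
        cnt>0 = ℚ.pos*pos⇒pos c (ι n ℚ.* t) {{ℚ.pos*pos⇒pos (ι n) t}}
        cnt≥0 = ℚ.pos⇒nonNeg (c ℚ.* (ι n ℚ.* t))
  in solve-for-g c (ι (γR G)) (ι n) (ι δ) (seq numer i) (seq denom i) t ε
       (Positiveᴿ.lower (^-positive {suc δ} {r = 1ℚᵘ ℚᵘ.+ + 1 / δ}) ℕ.z≤n)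
       (divide-through (γR G) n δ (X i) (Y i) i (γR-≤-roots G (suc i) (X i) (Y i) δ
         (λ v → subst (ℕ._≤ degree G v) minDeg≡δ (minDegree≤degree G v))
         (X-lower i) (Y-upper i)))
       (c*t≤ε (1/n≤ε η N≤i))
  where
  c = ι 2
  numer denom : ℝ
  numer = 2 ^ (+ 1 / δ)
  denom = (1 ℕ.+ δ) ^ (1ℚᵘ ℚᵘ.+ + 1 / δ)
  -- Unnormalised addition gives `1 * δ + 1 * 1` over `1 * δ`, equal to `suc δ` over `δ` only
  -- propositionally; `Y-upper` transports along these equations.
  p q : ℕ
  p = ℤ.∣ ℚᵘ.↥ (1ℚᵘ ℚᵘ.+ + 1 / δ) ∣
  q = ℚᵘ.↧ₙ (1ℚᵘ ℚᵘ.+ + 1 / δ)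
  X Y : ℕ → ℕ
  X i = ⌊root⌋ δ (2 ℕ.* suc i ℕ.^ δ)
  Y i = ⌊root⌋ q (suc δ ℕ.^ p ℕ.* suc i ℕ.^ q)
  X-lower : ∀ i → X i ℕ.^ δ ℕ.≤ 2 ℕ.* suc i ℕ.^ δ
  X-lower i = ⌊root⌋-lower δ _
  Y-upper : ∀ i → suc δ ℕ.^ suc δ ℕ.* suc i ℕ.^ δ ℕ.≤ suc (Y i) ℕ.^ δ
  Y-upper i = subst₂ (λ p′ q′ → suc δ ℕ.^ p′ ℕ.* suc i ℕ.^ q′ ℕ.≤ suc (Y i) ℕ.^ q′) p≡1+δ q≡δ
    (ℕ.<⇒≤ (⌊root⌋-upper q _))
    where
    p≡1+δ : p ≡ suc δ
    p≡1+δ = cong suc (trans (cong (ℕ._+ 1) (ℕ.+-identityʳ j)) (ℕ.+-comm j 1))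
    q≡δ : q ≡ δ
    q≡δ = cong suc (ℕ.+-identityʳ j)
  instance
    n>0 : Positive (ι n)
    n>0 = ℚ.normalize-pos n 1
    cn>0 : Positive (c ℚ.* ι n)
    cn>0 = ℚ.pos*pos⇒pos c (ι n)
  -- Chosen so that `c * (ι n * η)` is `ε`: the slack `2n / suc i` is at most `ε` once
  -- `1 / suc i ≤ η`.
  η : ℚ
  η = ε ℚ.* pos⁻¹ (c ℚ.* ι n)
  instance
    η>0 : Positive η
    η>0 = ℚ.pos*pos⇒pos ε (pos⁻¹ (c ℚ.* ι n)) {{pos⁻¹-pos (c ℚ.* ι n)}}
  c*t≤ε : ∀ {t} → t ℚ.≤ η → c ℚ.* (ι n ℚ.* t) ℚ.≤ ε
  c*t≤ε {t} t≤η = begin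
    c ℚ.* (ι n ℚ.* t)                                   ≡⟨ ℚ.*-assoc c (ι n) t ⟨
    c ℚ.* ι n ℚ.* t                                     ≤⟨ ℚ.*-monoˡ-≤-nonNeg (c ℚ.* ι n) {{ℚ.pos⇒nonNeg (c ℚ.* ι n)}} t≤η ⟩
    c ℚ.* ι n ℚ.* (ε ℚ.* pos⁻¹ (c ℚ.* ι n))             ≡⟨ solve 3 (λ m e r → m :* (e :* r) := e :* (m :* r)) refl (c ℚ.* ι n) ε _ ⟩
    ε ℚ.* (c ℚ.* ι n ℚ.* pos⁻¹ (c ℚ.* ι n))             ≡⟨ cong (ε ℚ.*_) (pos⁻¹-inverse (c ℚ.* ι n)) ⟩
    ε ℚ.* 1ℚ                                            ≡⟨ ℚ.*-identityʳ ε ⟩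
    ε                                                   ∎
    where
    open ℚ.≤-Reasoning
    open +-*-Solver
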